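{- Let $n\ge 0$ be an integer and let $\mathcal T_n$ be the set of deals defined in the context. Then for every integer $k$ with $0\le k\le n$: (i) the number of deals in $\mathcal T_n$ whose denomination set $S$ satisfies $|S|=k$ is $$\binom{n}{k}\sum_{j=0}^{k}\binom{k}{j}^{3};$$ (ii) the number of deals in $\mathcal T_n$ for which exactly $k$ distinct denominations occur in the red player's hand is $$\binom{n}{k}^{2}\binom{2k}{k}.$$
   Context: Consider a deck of $3n$ distinct cards: for each color in $\{\text{red},\text{green},\text{blue}\}$ and each denomination $i\in\{1,\dots,n\}$ there is exactly one card of that color and denomination. A deal in $\mathcal T_n$ is obtained as follows: choose a subset $S\subseteq\{1,\dots,n\}$ of the denominations (possibly empty), and partition all $3|S|$ cards whose denomination lies in $S$ into an ordered list of three sets (hands) $(H_{\mathrm{red}},H_{\mathrm{green}},H_{\mathrm{blue}})$ of equal size (so each has $|S|$ cards), such that $H_{\mathrm{red}}$ contains no red card, $H_{\mathrm{green}}$ contains no green card, and $H_{\mathrm{blue}}$ contains no blue card. The hands are unordered sets of cards, and $H_{c}$ is called the hand of the player designated $c$. When $S=\emptyset$ all three hands are empty, which gives one deal. $\mathcal T_n$ is the set of all triples $(H_{\mathrm{red}},H_{\mathrm{green}},H_{\mathrm{blue}})$ obtained in this way, over all choices of $S$; $S$ is the denomination set of the deal. A denomination $i$ occurs in a hand if the hand contains at least one card of denomination $i$. -}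

module Defs where

open import Data.Fin.Base using (Fin; zero; suc; combine)
open import Data.Fin.Properties using (any?)
open import Data.Fin.Subset using (Subset; _∈_; _∉_; _⊆_; ∣_∣)
open import Data.Fin.Subset.Properties using (_∈?_; ⊆-antisym)
open import Data.Nat.Base using (ℕ; _*_)
open import Data.Product.Base using (∃-syntax; _×_; _,_)
open import Data.Vec.Base using (tabulate)
open import Relation.Binary.PropositionalEquality using (_≡_)
open import Relation.Nullary.Decidable using (does)

Color : Set
Color = Fin 3

pattern red   = zero
pattern green = suc zero
pattern blue  = suc (suc zero)

-- Denominations are numbered 0, …, n-1 instead of 1, …, n.
Denomination : ℕ → Set
Denomination n = Fin n

Card : ℕ → Set
Card n = Fin (3 * n)

-- `combine` is one half of a bijection Fin 3 × Fin n ↔ Fin (3 * n), so every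
-- card is `card c i` for exactly one color c and one denomination i.
card : ∀ {n} → Color → Denomination n → Card n
card = combine

Hand : ℕ → Set
Hand n = Subset (3 * n)

-- Since subsets are bit vectors, propositional equality of triples of hands is
-- extensional equality, hence counting elements of this type counts triples
-- of sets.
record Hands (n : ℕ) : Set where
  constructor hands
  field
    redHand greenHand blueHand : Hand n

hand : ∀ {n} → Hands n → Color → Hand n
hand H red   = Hands.redHand H
hand H green = Hands.greenHand H
hand H blue  = Hands.blueHand H

record IsDealOn {n : ℕ} (S : Subset n) (H : Hands n) : Set where
  field
    -- The three hands partition the cards with denomination in S.
    covers    : ∀ c {i : Denomination n} → i ∈ S → ∃[ p ] card c i ∈ hand H p
    within    : ∀ p c {i : Denomination n} → card c i ∈ hand H p → i ∈ S
    disjoint  : ∀ p q {x : Card n} → x ∈ hand H p → x ∈ hand H q → p ≡ q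
    equalSize : ∀ p q → ∣ hand H p ∣ ≡ ∣ hand H q ∣
    avoids    : ∀ c (i : Denomination n) → card c i ∉ hand H c

-- The set 𝒯ₙ, as a predicate on triples of hands.
IsDeal : ∀ {n} → Hands n → Set
IsDeal H = ∃[ S ] IsDealOn S H

-- By uniqueness, ∃[ S ] (IsDealOn S H × ∣ S ∣ ≡ k) says that H is a deal whose
-- denomination set has size k.
denominationSet-unique : ∀ {n} {S S′ : Subset n} {H : Hands n} →
                         IsDealOn S H → IsDealOn S′ H → S ≡ S′
denominationSet-unique d d′ = ⊆-antisym (sub d d′) (sub d′ d)
  where
  sub : ∀ {n} {S S′ : Subset n} {H : Hands n} →
        IsDealOn S H → IsDealOn S′ H → S ⊆ S′
  sub d d′ i∈S with p , x∈Hp ← IsDealOn.covers d red i∈S =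
    IsDealOn.within d′ p red x∈Hp

occurringDenominations : ∀ {n} → Hands n → Color → Subset n
occurringDenominations H p =
  tabulate λ i → does (any? λ c → card c i ∈? hand H p)

-- Seat the players in the cycle red → green → blue → red. A card cannot go to
-- the player of its own color, so a dealt denomination amounts to three bits
-- x, y, z saying whether its red, green and blue card goes to the next player.
-- The hands have equal size iff x, y and z are true equally often, which gives
-- the sum of cubes in (i).
--
-- For (ii), let K be the set of dealt denominations with ¬ (y ∧ ¬ z), which are
-- those occurring in the red hand, and L the set of those with ¬ (z ∧ ¬ y). The
-- denominations in both K and L carry two further bits, x and ¬ y, and those in
-- exactly one of them carry one further bit, x: there are |K| + |L| bits
-- altogether. With u the number of denominations with y = z = false we have
-- |z| + u = |K|, |y| + u = |L|, and |x| + u is the number of true further bits.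
-- So a deal with |K| = k is the same as two k-subsets of the denominations
-- together with a k-subset of 2k positions.
module Submission where

open import Defs
open import Data.Bool.Base using (Bool; true; false; not; _∨_; if_then_else_)
import Data.Bool.Properties as Bool
open import Data.Fin.Base using (Fin; zero; suc; toℕ; fromℕ<; combine; remQuot; _↑ˡ_; _↑ʳ_)
import Data.Fin.Properties as Fin
open import Data.Fin.Subset using (Subset; _∈_; ∣_∣)
open import Data.Fin.Subset.Properties using (_∈?_; ∣p∣≤n)
open import Data.List.Base using (map; sum; upTo; applyUpTo)
open import Data.List.Properties using (map-upTo)
open import Data.Maybe.Base using (Maybe; just; nothing; is-just)
open import Data.Nat.Base using (ℕ; zero; suc; _+_; _*_; _^_; _≤_; _<_; s≤s)
open import Data.Nat.Combinatorics using (_C_; nCk+nC[k+1]≡[n+1]C[k+1])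
open import Data.Nat.Properties
  using (+-assoc; +-comm; +-identityʳ; +-cancelˡ-≡; +-cancelʳ-≡; *-identityʳ; *-cancelˡ-≡; suc-injective)
open import Data.Nat.Solver using (module +-*-Solver)
open import Data.Irrelevant using ([_])
open import Data.Product.Base using (Σ; ∃-syntax; _×_; _,_; proj₁; proj₂; uncurry)
open import Data.Product.Algebra using (×-cong)
open import Data.Refinement.Base using (Refinement-syntax; _,_)
open import Data.Refinement.Properties using (value-injective)
open import Data.Sum.Algebra using (⊎-cong)
open import Data.Sum.Base using (_⊎_; inj₁; inj₂)
open import Data.Vec.Base as Vec using (Vec; []; _∷_; _++_; take; drop; cast; lookup; tabulate; unzip)
open import Data.Vec.Properties
  using (map-cong; map-∘; map-++; sum-++; take++drop≡id; ++-injective; ≡-dec; lookup-map;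
         lookup∘tabulate; tabulate∘lookup; tabulate-cong; tabulate-∘; []=⇒lookup; lookup⇒[]=; ×v↔v×)
open import Data.Vec.Relation.Binary.Equality.Cast using (cast-is-id; cast-trans)
open import Function.Base using (_∘_; id)
open import Function.Bundles using (_↔_; _⇔_; mk↔ₛ′; mk⇔; Inverse; Equivalence)
open import Function.Properties.Inverse using (↔-refl; ↔-sym; ↔-trans)
open import Function.Related.Propositional using (≡⇒)
open import Relation.Binary.PropositionalEquality
open import Relation.Nullary.Decidable using (Dec; does; yes; no; recompute; map′; _×-dec_)
open import Relation.Nullary.Negation using (contradiction)

private
  variable
    A B X : Set
    m n : ℕ

-- Refinements

-- Proofs inside a refinement are irrelevant, so both round trips reduce to those of `f` on values.
refine-↔ : {P : A → Set} {Q : B → Set} (f : A ↔ B) →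
           (∀ a → P a ⇔ Q (Inverse.to f a)) →
           [ a ∈ A ∣ P a ] ↔ [ b ∈ B ∣ Q b ]
refine-↔ {Q = Q} f P⇔Q = mk↔ₛ′
  (λ (a , [ p ]) → f.to a , [ Equivalence.to (P⇔Q a) p ])
  (λ (b , [ q ]) → f.from b ,
    [ Equivalence.from (P⇔Q _) (subst Q (sym (f.strictlyInverseˡ b)) q) ])
  (λ (b , _) → value-injective (f.strictlyInverseˡ b))
  (λ (a , _) → value-injective (f.strictlyInverseʳ a))
  where module f = Inverse f

refine-× : {P : A → Set} {Q : B → Set} →
           [ ab ∈ A × B ∣ P (proj₁ ab) × Q (proj₂ ab) ] ↔
           ([ a ∈ A ∣ P a ] × [ b ∈ B ∣ Q b ])
refine-× = mk↔ₛ′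
  (λ ((a , b) , [ pq ]) → (a , [ proj₁ pq ]) , (b , [ proj₂ pq ]))
  (λ ((a , [ p ]) , (b , [ q ])) → (a , b) , [ (p , q) ])
  (λ _ → refl)
  (λ _ → refl)

-- When Q fixes the length f a of the vector, the dependent pair is a plain
-- product.
refine-Σ-Vec : {Q : A → Set} (R : ∀ {m} → Vec X m → Set) (f : A → ℕ) →
               (∀ a → Q a → f a ≡ m) →
               [ av ∈ Σ A (Vec X ∘ f) ∣ Q (proj₁ av) × R (proj₂ av) ] ↔
               ([ a ∈ A ∣ Q a ] × [ v ∈ Vec X m ∣ R v ])
refine-Σ-Vec {X = X} R f fixes = mk↔ₛ′
  -- `cast` takes its equation irrelevantly, so the erased `qr` is enough to fix the length.
  (λ ((a , v) , [ qr ]) → (a , [ proj₁ qr ]) ,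
    (cast (fixes a (proj₁ qr)) v , [ R-cast (fixes a (proj₁ qr)) (proj₂ qr) ]))
  (λ ((a , [ q ]) , (v , [ r ])) →
    (a , cast (sym (fixes a q)) v) , [ (q , R-cast (sym (fixes a q)) r) ])
  (λ ((a , [ q ]) , (v , [ r ])) →
    cong ((a , [ q ]) ,_) (value-injective (cast-inverse (sym (fixes a q)) (fixes a q) v)))
  (λ ((a , v) , [ qr ]) →
    value-injective (cong (a ,_)
      (cast-inverse (fixes a (proj₁ qr)) (sym (fixes a (proj₁ qr))) v)))
  where
  R-cast : ∀ {k l} (eq : k ≡ l) {v : Vec X k} → R v → R (cast eq v)
  R-cast refl {v} = subst R (sym (cast-is-id refl v))

  cast-inverse : ∀ {k l} .(eq : k ≡ l) .(eq′ : l ≡ k) (v : Vec X k) →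
                 cast eq′ (cast eq v) ≡ v
  cast-inverse eq eq′ v =
    trans (cast-trans eq eq′ v) (cast-is-id (trans eq eq′) v)

-- Total weights of vectors

bit : Bool → ℕ
bit b = if b then 1 else 0

total : (A → ℕ) → Vec A n → ℕ
total f v = Vec.sum (Vec.map f v)

total-+ : (f g : A → ℕ) (v : Vec A n) →
          total (λ a → f a + g a) v ≡ total f v + total g v
total-+ f g []      = refl
total-+ f g (a ∷ v) = trans (cong (f a + g a +_) (total-+ f g v))
  (solve 4 (λ p q r s → p :+ q :+ (r :+ s) := p :+ r :+ (q :+ s)) refl
    (f a) (g a) (total f v) (total g v))
  where open +-*-Solver

total-cong : {f g : A → ℕ} → f ≗ g → (v : Vec A n) → total f v ≡ total g v
total-cong f≗g v = cong Vec.sum (map-cong f≗g v)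

total-map : (f : B → ℕ) (g : A → B) (v : Vec A n) →
            total f (Vec.map g v) ≡ total (f ∘ g) v
total-map f g v = cong Vec.sum (sym (map-∘ f g v))

total-++ : (f : A → ℕ) (u : Vec A m) (v : Vec A n) →
           total f (u ++ v) ≡ total f u + total f v
total-++ f u v = trans (cong Vec.sum (map-++ f u v)) (sum-++ (Vec.map f u))

total-tabulate : (f : A → ℕ) (v : Vec A n) →
                 total f v ≡ Vec.sum (tabulate (f ∘ lookup v))
total-tabulate f []      = refl
total-tabulate f (a ∷ v) = cong (f a +_) (total-tabulate f v)

total-+-cong : {f g h : A → ℕ} → (∀ a → f a + g a ≡ h a) → (v : Vec A n) →
               total f v + total g v ≡ total h v
total-+-cong {f = f} {g} f+g≗h v =
  trans (sym (total-+ f g v)) (total-cong f+g≗h v)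

-- Keeping summands on both sides avoids subtraction when gains and losses are compared letter by
-- letter.
total-exchange : {f g h k : A → ℕ} → (∀ a → f a + g a ≡ h a + k a) →
                 (v : Vec A n) → total f v + total g v ≡ total h v + total k v
total-exchange {h = h} {k} f+g≗h+k v =
  trans (total-+-cong f+g≗h+k v) (total-+ h k v)

total-unzip₁ : (f : A → ℕ) (v : Vec (A × B) n) →
               total f (proj₁ (unzip v)) ≡ total (f ∘ proj₁) v
total-unzip₁ f []      = refl
total-unzip₁ f (x ∷ v) = cong (f (proj₁ x) +_) (total-unzip₁ f v)

total-unzip₂ : (f : B → ℕ) (v : Vec (A × B) n) →
               total f (proj₂ (unzip v)) ≡ total (f ∘ proj₂) v
total-unzip₂ f []      = refl
total-unzip₂ f (x ∷ v) = cong (f (proj₂ x) +_) (total-unzip₂ f v)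

∣∣-total : (S : Subset n) → ∣ S ∣ ≡ total bit S
∣∣-total []          = refl
∣∣-total (true  ∷ S) = cong suc (∣∣-total S)
∣∣-total (false ∷ S) = ∣∣-total S

-- Vectors over a sum type, sorted into shapes and contents

-- Used with `optional↔`, where the shapes tell which denominations are dealt, and with `pair↔`,
-- where they tell membership in K and L. The contents of all letters are concatenated, so their
-- positions can be counted independently of the shapes once the total arity is known.
module Sorting {Shape : Set} {arity : Shape → ℕ}
               (iso : A ↔ Σ Shape (Vec X ∘ arity)) where

  private module iso = Inverse iso

  Sorted : ℕ → Set
  Sorted n = Σ (Vec Shape n) (Vec X ∘ total arity)

  shape : A → Shape
  shape = proj₁ ∘ iso.to

  content : (a : A) → Vec X (arity (shape a))
  content = proj₂ ∘ iso.to

  _◂_ : Σ Shape (Vec X ∘ arity) → Sorted n → Sorted (suc n)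
  (s , xs) ◂ (v , ys) = s ∷ v , xs ++ ys

  sort : Vec A n → Sorted n
  sort []      = [] , []
  sort (a ∷ w) = iso.to a ◂ sort w

  unsort : (v : Vec Shape n) → Vec X (total arity v) → Vec A n
  unsort []      _  = []
  unsort (s ∷ v) xs =
    iso.from (s , take (arity s) xs) ∷ unsort v (drop (arity s) xs)

  sort-unsort : (v : Vec Shape n) (xs : Vec X (total arity v)) →
                sort (unsort v xs) ≡ (v , xs)
  sort-unsort []      [] = refl
  sort-unsort (s ∷ v) xs = trans
    (cong₂ _◂_ (iso.strictlyInverseˡ _) (sort-unsort v (drop (arity s) xs)))
    (cong (s ∷ v ,_) (take++drop≡id (arity s) xs))

  unsort-sort : (w : Vec A n) → uncurry unsort (sort w) ≡ w
  unsort-sort []      = refl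
  unsort-sort (a ∷ w) = cong₂ _∷_
    (trans (cong (iso.from ∘ (shape a ,_)) (proj₁ split≡))
           (iso.strictlyInverseʳ a))
    (trans (cong (unsort (proj₁ (sort w))) (proj₂ split≡)) (unsort-sort w))
    where
    -- Taking and dropping `arity (shape a)` entries of this concatenation returns its two halves.
    split≡ = ++-injective _ (content a)
      (take++drop≡id (arity (shape a)) (content a ++ proj₂ (sort w)))

  sort↔ : Vec A n ↔ Sorted n
  sort↔ = mk↔ₛ′ sort (uncurry unsort) (uncurry sort-unsort) unsort-sort

  total-shapes : (f : Shape → ℕ) (w : Vec A n) →
                 total f (proj₁ (sort w)) ≡ total (f ∘ shape) w
  total-shapes f []      = refl
  total-shapes f (a ∷ w) = cong (f (shape a) +_) (total-shapes f w)

  total-contents : (f : X → ℕ) (w : Vec A n) →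
                   total f (proj₂ (sort w)) ≡ total (total f ∘ content) w
  total-contents f []      = refl
  total-contents f (a ∷ w) = trans (total-++ f (content a) (proj₂ (sort w)))
    (cong (total f (content a) +_) (total-contents f w))

-- Subsets of given size

-- The size is written `total bit S` rather than `∣ S ∣` to fit the lemmas on totals.
Choice : ℕ → ℕ → Set
Choice n k = [ S ∈ Subset n ∣ total bit S ≡ k ]

-- Pascal's rule, splitting by whether the first element is chosen.
choice↔ : ∀ n k → Choice n k ↔ Fin (n C k)
choice↔ zero zero = mk↔ₛ′ (λ _ → zero) (λ _ → [] , [ refl ])
  (λ { zero → refl }) (λ { ([] , _) → refl })
choice↔ zero (suc k) = mk↔ₛ′ (λ { ([] , [ () ]) }) (λ ()) (λ ())
  (λ { ([] , [ () ]) })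
choice↔ (suc n) zero = ↔-trans outside-only (choice↔ n zero)
  where
  outside-only : Choice (suc n) zero ↔ Choice n zero
  outside-only = mk↔ₛ′
    (λ { (true ∷ _ , [ () ]) ; (false ∷ S , p) → S , p })
    (λ (S , p) → false ∷ S , p)
    (λ _ → refl)
    (λ { (true ∷ _ , [ () ]) ; (false ∷ _ , _) → refl })
choice↔ (suc n) (suc k) =
  subst (λ m → Choice (suc n) (suc k) ↔ Fin m) (nCk+nC[k+1]≡[n+1]C[k+1] n k)
    (↔-trans pascal
      (↔-trans (⊎-cong (choice↔ n k) (choice↔ n (suc k))) (↔-sym Fin.+↔⊎)))
  where
  pascal : Choice (suc n) (suc k) ↔ (Choice n k ⊎ Choice n (suc k))
  pascal = mk↔ₛ′
    (λ { (true  ∷ S , [ p ]) → inj₁ (S , [ suc-injective p ])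
       ; (false ∷ S , p)     → inj₂ (S , p) })
    (λ { (inj₁ (S , [ p ])) → true ∷ S , [ cong suc p ]
       ; (inj₂ (S , p))     → false ∷ S , p })
    (λ { (inj₁ _) → refl ; (inj₂ _) → refl })
    (λ { (true ∷ _ , _) → refl ; (false ∷ _ , _) → refl })

-- Triples of equally large subsets

Σ-Fin-↔ : ∀ m (f : ℕ → ℕ) →
          Σ (Fin m) (Fin ∘ f ∘ toℕ) ↔ Fin (sum (map f (upTo m)))
-- `applyUpTo f m` unfolds along the recursion on `m`, with `f` shifted by `suc` at each step.
Σ-Fin-↔ m f = subst (λ l → Σ (Fin m) (Fin ∘ f ∘ toℕ) ↔ Fin (sum l))
  (sym (map-upTo f m)) (go m f)
  where
  go : ∀ m f → Σ (Fin m) (Fin ∘ f ∘ toℕ) ↔ Fin (sum (applyUpTo f m))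
  go zero    f = mk↔ₛ′ (λ ()) (λ ()) (λ ()) (λ ())
  go (suc m) f =
    ↔-trans first-or-later
      (↔-trans (⊎-cong ↔-refl (go m (f ∘ suc))) (↔-sym Fin.+↔⊎))
    where
    first-or-later : Σ (Fin (suc m)) (Fin ∘ f ∘ toℕ) ↔
                     (Fin (f 0) ⊎ Σ (Fin m) (Fin ∘ f ∘ suc ∘ toℕ))
    first-or-later = mk↔ₛ′
      (λ { (zero , x) → inj₁ x ; (suc j , x) → inj₂ (j , x) })
      (λ { (inj₁ x) → zero , x ; (inj₂ (j , x)) → suc j , x })
      (λ { (inj₁ _) → refl ; (inj₂ _) → refl })
      (λ { (zero , _) → refl ; (suc _ , _) → refl })

Σ-cong-↔ : {P Q : A → Set} → (∀ a → P a ↔ Q a) → Σ A P ↔ Σ A Q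
Σ-cong-↔ P↔Q = mk↔ₛ′
  (λ (a , p) → a , Inverse.to (P↔Q a) p)
  (λ (a , q) → a , Inverse.from (P↔Q a) q)
  (λ (a , q) → cong (a ,_) (Inverse.strictlyInverseˡ (P↔Q a) q))
  (λ (a , p) → cong (a ,_) (Inverse.strictlyInverseʳ (P↔Q a) p))

EqualSizes : Subset n × Subset n × Subset n → Set
EqualSizes (S , T , U) = total bit S ≡ total bit T × total bit T ≡ total bit U

-- A subset of a `k`-set has one of the `suc k` sizes from 0 to `k`; the size of the first subset
-- serves as the index.
by-common-size : ∀ k →
  [ STU ∈ Subset k × Subset k × Subset k ∣ EqualSizes STU ] ↔
  Σ (Fin (suc k)) (λ j → Choice k (toℕ j) × Choice k (toℕ j) × Choice k (toℕ j))
by-common-size k = mk↔ₛ′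
  (λ ((S , T , U) , [ eqs ]) → size S ,
    (S , [ sym (toℕ-size S) ]) ,
    (T , [ trans (sym (proj₁ eqs)) (sym (toℕ-size S)) ]) ,
    (U , [ trans (sym (trans (proj₁ eqs) (proj₂ eqs))) (sym (toℕ-size S)) ]))
  (λ (j , (S , [ p ]) , (T , [ q ]) , (U , [ r ])) →
    (S , T , U) , [ (trans p (sym q) , trans q (sym r)) ])
  (λ (j , (S , [ p ]) , (T , [ q ]) , (U , [ r ])) →
    -- The proof `p` is irrelevant; deciding `size S ≡ j` recovers an equation that can be matched
    -- on.
    same-size
      (recompute (size S Fin.≟ j) (Fin.toℕ-injective (trans (toℕ-size S) p))))
  (λ _ → refl)
  where
  size≤ : (S : Subset k) → total bit S < suc k
  size≤ S = s≤s (subst (_≤ k) (∣∣-total S) (∣p∣≤n S))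

  size : Subset k → Fin (suc k)
  size S = fromℕ< (size≤ S)

  toℕ-size : (S : Subset k) → toℕ (size S) ≡ total bit S
  toℕ-size S = Fin.toℕ-fromℕ< (size≤ S)

  same-size : ∀ {i j : Fin (suc k)} {S T U : Subset k}
    .{p p′ q q′ r r′} → i ≡ j →
    _≡_ {A = Σ (Fin (suc k)) (λ j → Choice k (toℕ j) × Choice k (toℕ j) × Choice k (toℕ j))}
      (i , (S , [ p ]) , (T , [ q ]) , (U , [ r ]))
      (j , (S , [ p′ ]) , (T , [ q′ ]) , (U , [ r′ ]))
  same-size refl = refl

Fin-cube-↔ : ∀ m → (Fin m × Fin m × Fin m) ↔ Fin (m ^ 3)
Fin-cube-↔ m =
  -- `m ^ 3` unfolds to `m * (m * (m * 1))`, so the innermost factor is rewritten.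
  subst (λ l → (Fin m × Fin m × Fin m) ↔ Fin (m * (m * l))) (sym (*-identityʳ m))
    (↔-trans (×-cong ↔-refl (↔-sym Fin.*↔×)) (↔-sym Fin.*↔×))

Fin-square-↔ : ∀ m → (Fin m × Fin m) ↔ Fin (m ^ 2)
Fin-square-↔ m =
  subst (λ l → (Fin m × Fin m) ↔ Fin (m * l)) (sym (*-identityʳ m)) (↔-sym Fin.*↔×)

equal-sizes↔ : ∀ k →
  [ STU ∈ Subset k × Subset k × Subset k ∣ EqualSizes STU ] ↔
  Fin (sum (map (λ j → (k C j) ^ 3) (upTo (suc k))))
equal-sizes↔ k =
  ↔-trans (by-common-size k)
    (↔-trans (Σ-cong-↔ λ j → let c = choice↔ k (toℕ j) in
                ↔-trans (×-cong c (×-cong c c)) (Fin-cube-↔ (k C toℕ j)))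
             (Σ-Fin-↔ (suc k) (λ j → (k C j) ^ 3)))

-- Deals as words of fates

-- The bits x, y, z of a dealt denomination.
Fate : Set
Fate = Maybe (Bool × Bool × Bool)

owns : Fate → (player card : Color) → Bool
owns nothing            _     _     = false
owns (just (x , y , z)) red   red   = false
owns (just (x , y , z)) green red   = x
owns (just (x , y , z)) blue  red   = not x
owns (just (x , y , z)) red   green = not y
owns (just (x , y , z)) green green = false
owns (just (x , y , z)) blue  green = y
owns (just (x , y , z)) red   blue  = z
owns (just (x , y , z)) green blue  = not z
owns (just (x , y , z)) blue  blue  = false

-- Naming the one holder of each card gives covering through `owns-holder` and disjointness through
-- `holder-unique`.
holder : Bool × Bool × Bool → Color → Color
holder (x , y , z) red   = if x then green else blue
holder (x , y , z) green = if y then blue else red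
holder (x , y , z) blue  = if z then red else green

owns-holder : ∀ b c → owns (just b) (holder b c) c ≡ true
owns-holder (true  , _ , _) red   = refl
owns-holder (false , _ , _) red   = refl
owns-holder (_ , true  , _) green = refl
owns-holder (_ , false , _) green = refl
owns-holder (_ , _ , true ) blue  = refl
owns-holder (_ , _ , false) blue  = refl

holder-unique : ∀ c p b → owns (just b) p c ≡ true → p ≡ holder b c
holder-unique red   green (true  , _ , _) refl = refl
holder-unique red   blue  (false , _ , _) refl = refl
holder-unique green blue  (_ , true  , _) refl = refl
holder-unique green red   (_ , false , _) refl = refl
holder-unique blue  red   (_ , _ , true ) refl = refl
holder-unique blue  green (_ , _ , false) refl = refl
holder-unique blue  blue  _               ()

owns-unique : ∀ f p q c → owns f p c ≡ true → owns f q c ≡ true → p ≡ q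
owns-unique (just b) p q c e e′ =
  trans (holder-unique c p b e) (sym (holder-unique c q b e′))

owns-dealt : ∀ f p c → owns f p c ≡ true → is-just f ≡ true
owns-dealt (just _) _ _ _ = refl

dealt-owned : ∀ f c → is-just f ≡ true → ∃[ p ] owns f p c ≡ true
dealt-owned (just b) c _ = holder b c , owns-holder b c

owns-avoids : ∀ f c → owns f c c ≡ false
owns-avoids nothing  _     = refl
owns-avoids (just _) red   = refl
owns-avoids (just _) green = refl
owns-avoids (just _) blue  = refl

-- Translation between words and deals

holds : Hands n → Denomination n → (player card : Color) → Bool
holds H i p c = lookup (hand H p) (card c i)

deal : Vec Fate n → Hands n
deal {n} w = hands (h red) (h green) (h blue)
  where
  h : Color → Hand n
  h p = tabulate λ x → let c , i = remQuot n x in owns (lookup w i) p c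

holds-deal : ∀ (w : Vec Fate n) i p c → holds (deal w) i p c ≡ owns (lookup w i) p c
holds-deal {n} w i p c = trans (lookup-hand p)
  (cong (λ (c , i) → owns (lookup w i) p c) (Fin.remQuot-combine c i))
  where
  -- `hand` computes only at a concrete color, so the players are treated one by one.
  lookup-hand : ∀ p → lookup (hand (deal w) p) (card c i) ≡
    (let c , i = remQuot n (card c i) in owns (lookup w i) p c)
  lookup-hand red   = lookup∘tabulate _ (card c i)
  lookup-hand green = lookup∘tabulate _ (card c i)
  lookup-hand blue  = lookup∘tabulate _ (card c i)

-- The last argument is the other possible holder of the red card.
mkFate : (x y z x′ : Bool) → Fate
mkFate x y z x′ = if x ∨ x′ then just (x , y , z) else nothing

-- In a deal, a denomination is dealt iff its red card is held by green or blue. On other triples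
-- the value carries no meaning.
fate : Hands n → Denomination n → Fate
fate H i = mkFate (holds H i green red) (holds H i blue green) (holds H i red blue)
                  (holds H i blue red)

word : Hands n → Vec Fate n
word H = tabulate (fate H)

word-deal : (w : Vec Fate n) → word (deal w) ≡ w
word-deal w = trans (tabulate-cong fate-deal) (tabulate∘lookup w)
  where
  mkFate-owns : ∀ f → mkFate (owns f green red) (owns f blue green)
                             (owns f red blue) (owns f blue red) ≡ f
  mkFate-owns nothing            = refl
  mkFate-owns (just (true  , _)) = refl
  mkFate-owns (just (false , _)) = refl

  fate-deal : ∀ i → fate (deal w) i ≡ lookup w i
  fate-deal i rewrite holds-deal w i green red | holds-deal w i blue green
                    | holds-deal w i red blue | holds-deal w i blue red =
    mkFate-owns (lookup w i)

module _ {S : Subset n} {H : Hands n} (d : IsDealOn S H) where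
  open IsDealOn d

  private
    toBit : ∀ {x} {p : Subset m} → x ∈ p → lookup p x ≡ true
    toBit = []=⇒lookup

    ofBit : ∀ {x} {p : Subset m} → lookup p x ≡ true → x ∈ p
    ofBit {x = x} {p} = lookup⇒[]= x p

  holds-outside : ∀ {i} → lookup S i ≡ false → ∀ p c → holds H i p c ≡ false
  holds-outside i∉S p c = Bool.¬-not λ e →
    contradiction (trans (sym i∉S) (toBit (within p c (ofBit e)))) λ ()

  holds-diagonal : ∀ i c → holds H i c c ≡ false
  holds-diagonal i c = Bool.¬-not (avoids c i ∘ ofBit)

  -- Disjointness forbids that both `p` and `q` hold the card; covering and avoidance force one of
  -- them to hold it, as `cases` leaves no player besides `c`, `p` and `q`.
  holds-complement : ∀ {i} → lookup S i ≡ true → ∀ {p q} c → p ≢ q →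
                     (∀ r → r ≡ c ⊎ r ≡ p ⊎ r ≡ q) →
                     holds H i q c ≡ not (holds H i p c)
  holds-complement {i} i∈S {p} {q} c p≢q cases with holds H i p c in eq
  ... | true  = Bool.¬-not λ e → p≢q (disjoint p q (ofBit eq) (ofBit e))
  ... | false with r , x∈r ← covers c (ofBit i∈S) with cases r
  ...   | inj₁ refl        = contradiction x∈r (avoids c i)
  ...   | inj₂ (inj₁ refl) = contradiction (trans (sym eq) (toBit x∈r)) λ ()
  ...   | inj₂ (inj₂ refl) = toBit x∈r

  -- Outside `S` nothing is held. Inside, the diagonal entries are false and the two others for each
  -- card are complementary, so three bits recover all nine entries.
  owns-fate : ∀ i p c → owns (fate H i) p c ≡ holds H i p c
  owns-fate i p c with lookup S i in eq
  owns-fate i p c | false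
    rewrite holds-outside eq green red | holds-outside eq blue red =
    sym (holds-outside eq p c)
  owns-fate i p c | true = trans (cong (λ f → owns f p c) fate≡bits) (owns-bits p c)
    where
    red-card : holds H i blue red ≡ not (holds H i green red)
    red-card = holds-complement eq red (λ ())
      λ { red → inj₁ refl ; green → inj₂ (inj₁ refl) ; blue → inj₂ (inj₂ refl) }

    green-card : holds H i red green ≡ not (holds H i blue green)
    green-card = holds-complement eq green (λ ())
      λ { green → inj₁ refl ; blue → inj₂ (inj₁ refl) ; red → inj₂ (inj₂ refl) }

    blue-card : holds H i green blue ≡ not (holds H i red blue)
    blue-card = holds-complement eq blue (λ ())
      λ { blue → inj₁ refl ; red → inj₂ (inj₁ refl) ; green → inj₂ (inj₂ refl) }

    bits : Bool × Bool × Bool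
    bits = holds H i green red , holds H i blue green , holds H i red blue

    fate≡bits : fate H i ≡ just bits
    -- The test in `mkFate` becomes a bit or its negation, hence true.
    fate≡bits rewrite red-card | Bool.∨-inverseʳ (holds H i green red) = refl

    owns-bits : ∀ p c → owns (just bits) p c ≡ holds H i p c
    owns-bits red   red   = sym (holds-diagonal i red)
    owns-bits green red   = refl
    owns-bits blue  red   = sym red-card
    owns-bits red   green = sym green-card
    owns-bits green green = sym (holds-diagonal i green)
    owns-bits blue  green = refl
    owns-bits red   blue  = refl
    owns-bits green blue  = sym blue-card
    owns-bits blue  blue  = sym (holds-diagonal i blue)

lookup-extensional : {u v : Vec A n} → lookup u ≗ lookup v → u ≡ v
lookup-extensional {u = u} {v} u≗v =
  trans (sym (tabulate∘lookup u)) (trans (tabulate-cong u≗v) (tabulate∘lookup v))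

holds-extensional : {H H′ : Hands n} →
                    (∀ i p c → holds H i p c ≡ holds H′ i p c) → H ≡ H′
holds-extensional {n} {H} {H′} same =
  hands-≡ (same-hand red) (same-hand green) (same-hand blue)
  where
  hands-≡ : ∀ {r g b r′ g′ b′ : Hand n} → r ≡ r′ → g ≡ g′ → b ≡ b′ →
            hands r g b ≡ hands r′ g′ b′
  hands-≡ refl refl refl = refl

  same-hand : ∀ p → hand H p ≡ hand H′ p
  same-hand p = lookup-extensional λ x → same-at x (Fin.combine-surjective {3} {n} x)
    where
    same-at : ∀ x → (∃[ c ] ∃[ i ] combine c i ≡ x) →
              lookup (hand H p) x ≡ lookup (hand H′ p) x
    same-at _ (c , i , refl) = same i p c

deal-word : {H : Hands n} → IsDeal H → deal (word H) ≡ H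
deal-word {H = H} (_ , d) = holds-extensional λ i p c →
  trans (holds-deal (word H) i p c)
    (trans (cong (λ f → owns f p c) (lookup∘tabulate (fate H) i)) (owns-fate d i p c))

-- Decidability serves to recover `deal (word H) ≡ H` from an irrelevant proof that `H` is a deal.
_≟ʰ_ : (H H′ : Hands n) → Dec (H ≡ H′)
hands r g b ≟ʰ hands r′ g′ b′ =
  map′ (λ { (refl , refl , refl) → refl }) (λ { refl → refl , refl , refl })
    (r ≟ r′ ×-dec g ≟ g′ ×-dec b ≟ b′)
  where _≟_ = ≡-dec Bool._≟_

-- `word` inverts `deal` on all words, but `deal` inverts `word` only under a hypothesis such as
-- `IsDeal`, so `refine-↔` does not apply.
refine-deals↔ : {P : Hands n → Set} {Q : Vec Fate n → Set} →
                (∀ {H} → P H → IsDeal H) → (∀ w → P (deal w) ⇔ Q w) →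
                [ H ∈ Hands n ∣ P H ] ↔ [ w ∈ Vec Fate n ∣ Q w ]
refine-deals↔ {P = P} isDeal P⇔Q = mk↔ₛ′
  (λ (H , [ p ]) → word H ,
    [ Equivalence.to (P⇔Q (word H)) (subst P (sym (deal-word (isDeal p))) p) ])
  (λ (w , [ q ]) → deal w , [ Equivalence.from (P⇔Q w) q ])
  (λ (w , _) → value-injective (word-deal w))
  (λ (H , [ p ]) →
    value-injective (recompute (deal (word H) ≟ʰ H) (deal-word (isDeal p))))

-- Hand sizes

sum-tabulate-+ : ∀ m {n} (f : Fin (m + n) → ℕ) →
                 Vec.sum (tabulate f) ≡
                 Vec.sum (tabulate (f ∘ (_↑ˡ n))) + Vec.sum (tabulate (f ∘ (m ↑ʳ_)))
sum-tabulate-+ zero    f = refl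
sum-tabulate-+ (suc m) f = trans (cong (f zero +_) (sum-tabulate-+ m (f ∘ suc)))
  (sym (+-assoc (f zero) _ _))

-- `combine zero` embeds the first block of `n` indices and `combine (suc c)` shifts past it, so
-- each color splits off one block.
sum-tabulate-combine : ∀ m {n} (f : Fin (m * n) → ℕ) →
  Vec.sum (tabulate f) ≡
  Vec.sum (tabulate λ c → Vec.sum (tabulate (f ∘ combine {m} {n} c)))
sum-tabulate-combine zero        f = refl
sum-tabulate-combine (suc m) {n} f = trans (sum-tabulate-+ n f)
  (cong (Vec.sum (tabulate (f ∘ (_↑ˡ m * n))) +_)
    (sum-tabulate-combine m (f ∘ (n ↑ʳ_))))

received : Color → Fate → ℕ
received p f = bit (owns f p red) + (bit (owns f p green) + bit (owns f p blue))

hand-size : (w : Vec Fate n) (p : Color) →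
            ∣ hand (deal w) p ∣ ≡ total (received p) w
hand-size {n} w p = begin
  ∣ hand (deal w) p ∣
    ≡⟨ ∣∣-total (hand (deal w) p) ⟩
  total bit (hand (deal w) p)
    ≡⟨ total-tabulate bit (hand (deal w) p) ⟩
  Vec.sum (tabulate (bit ∘ lookup (hand (deal w) p)))
    ≡⟨ sum-tabulate-combine 3 {n} (bit ∘ lookup (hand (deal w) p)) ⟩
  Vec.sum (tabulate λ c → Vec.sum (tabulate λ i → bit (holds (deal w) i p c)))
    ≡⟨ cong Vec.sum (tabulate-cong row) ⟩
  Vec.sum (tabulate λ c → total (ofColor c) w)
    -- The sum over the three colors unfolds with a trailing `+ 0`.
    ≡⟨ cong (λ m → total (ofColor red) w + (total (ofColor green) w + m))
            (+-identityʳ _) ⟩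
  total (ofColor red) w + (total (ofColor green) w + total (ofColor blue) w)
    ≡⟨ cong (total (ofColor red) w +_) (total-+ (ofColor green) (ofColor blue) w) ⟨
  total (ofColor red) w + total (λ f → ofColor green f + ofColor blue f) w
    ≡⟨ total-+ (ofColor red) _ w ⟨
  total (received p) w ∎
  where
  open ≡-Reasoning

  ofColor : Color → Fate → ℕ
  ofColor c f = bit (owns f p c)

  row : ∀ c → Vec.sum (tabulate λ i → bit (holds (deal w) i p c)) ≡ total (ofColor c) w
  row c = trans
    (cong Vec.sum (tabulate-cong λ i → cong bit (holds-deal w i p c)))
    (sym (total-tabulate (ofColor c) w))

dealt : Fate → ℕ
dealt f = bit (is-just f)

passed : Color → Fate → ℕ
passed _     nothing            = 0
passed red   (just (x , y , z)) = bit x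
passed green (just (x , y , z)) = bit y
passed blue  (just (x , y , z)) = bit z

-- A hand loses the passed cards of one color and gains those of another.
red-size : (w : Vec Fate n) → total (received red) w + total (passed green) w ≡
                              total dealt w + total (passed blue) w
red-size = total-exchange pointwise
  where
  pointwise : ∀ f → received red f + passed green f ≡ dealt f + passed blue f
  pointwise nothing                    = refl
  pointwise (just (_ , true  , true))  = refl
  pointwise (just (_ , true  , false)) = refl
  pointwise (just (_ , false , true))  = refl
  pointwise (just (_ , false , false)) = refl

green-size : (w : Vec Fate n) → total (received green) w + total (passed blue) w ≡
                                total dealt w + total (passed red) w
green-size = total-exchange pointwise
  where
  pointwise : ∀ f → received green f + passed blue f ≡ dealt f + passed red f
  pointwise nothing                    = refl
  pointwise (just (true  , _ , true))  = refl
  pointwise (just (true  , _ , false)) = refl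
  pointwise (just (false , _ , true))  = refl
  pointwise (just (false , _ , false)) = refl

blue-size : (w : Vec Fate n) → total (received blue) w + total (passed red) w ≡
                               total dealt w + total (passed green) w
blue-size = total-exchange pointwise
  where
  pointwise : ∀ f → received blue f + passed red f ≡ dealt f + passed green f
  pointwise nothing                    = refl
  pointwise (just (true  , true  , _)) = refl
  pointwise (just (true  , false , _)) = refl
  pointwise (just (false , true  , _)) = refl
  pointwise (just (false , false , _)) = refl

-- Equal hands and balanced words

Balanced : Vec Fate n → Set
Balanced w = total (passed red) w ≡ total (passed green) w ×
             total (passed green) w ≡ total (passed blue) w

-- Adding the three size equations gives 3 r = 3 s.
cyclic-sizes : ∀ {r s x y z} → r + y ≡ s + z → r + z ≡ s + x → r + x ≡ s + y →
               x ≡ y × y ≡ z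
cyclic-sizes {r} {s} {x} {y} {z} ry rz rx =
  +-cancelˡ-≡ s x y (trans (cong (_+ x) (sym r≡s)) rx) ,
  +-cancelˡ-≡ s y z (trans (cong (_+ y) (sym r≡s)) ry)
  where
  open +-*-Solver
  r≡s : r ≡ s
  r≡s = *-cancelˡ-≡ r s 3 (+-cancelʳ-≡ (x + y + z) (3 * r) (3 * s) (begin
    3 * r + (x + y + z)
      ≡⟨ solve 4 (λ r x y z → con 3 :* r :+ (x :+ y :+ z) :=
                   r :+ y :+ (r :+ z) :+ (r :+ x)) refl r x y z ⟩
    r + y + (r + z) + (r + x)
      ≡⟨ cong₂ _+_ (cong₂ _+_ ry rz) rx ⟩
    s + z + (s + x) + (s + y)
      ≡⟨ solve 4 (λ s x y z → s :+ z :+ (s :+ x) :+ (s :+ y) :=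
                   con 3 :* s :+ (x :+ y :+ z)) refl s x y z ⟩
    3 * s + (x + y + z) ∎))
    where open ≡-Reasoning

dealtSet : Vec Fate n → Subset n
dealtSet = Vec.map is-just

deal-balanced : (w : Vec Fate n) → Balanced w → IsDealOn (dealtSet w) (deal w)
deal-balanced {n} w (x≡y , y≡z) = record
  { covers    = λ c {i} i∈S →
      let p , e = dealt-owned (lookup w i) c
                    (trans (sym (lookup-map i is-just w)) ([]=⇒lookup i∈S))
      in p , lookup⇒[]= _ _ (trans (holds-deal w i p c) e)
  ; within    = λ p c {i} x∈p → lookup⇒[]= i (dealtSet w)
      (trans (lookup-map i is-just w) (owns-dealt (lookup w i) p c (owned i p c x∈p)))
  ; disjoint  = λ p q {x} → disjoint-at p q x (Fin.combine-surjective {3} {n} x)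
  ; equalSize = λ p q → trans (size p) (sym (size q))
  ; avoids    = λ c i x∈c →
      contradiction (trans (sym (owned i c c x∈c)) (owns-avoids (lookup w i) c)) λ ()
  }
  where
  owned : ∀ i p c → card c i ∈ hand (deal w) p → owns (lookup w i) p c ≡ true
  owned i p c x∈p = trans (sym (holds-deal w i p c)) ([]=⇒lookup x∈p)

  disjoint-at : ∀ p q x → (∃[ c ] ∃[ i ] combine c i ≡ x) →
                x ∈ hand (deal w) p → x ∈ hand (deal w) q → p ≡ q
  disjoint-at p q _ (c , i , refl) x∈p x∈q =
    owns-unique (lookup w i) p q c (owned i p c x∈p) (owned i q c x∈q)

  cancel : ∀ {r s x y} → x ≡ y → r + x ≡ s + y → r ≡ s
  cancel {r} {s} {x} refl = +-cancelʳ-≡ x r s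

  -- Balance cancels gains against losses, leaving one card per dealt denomination in each hand.
  size : ∀ p → ∣ hand (deal w) p ∣ ≡ total dealt w
  size red   = trans (hand-size w red) (cancel y≡z (red-size w))
  size green = trans (hand-size w green) (cancel (sym (trans x≡y y≡z)) (green-size w))
  size blue  = trans (hand-size w blue) (cancel x≡y (blue-size w))

-- With all hand sizes replaced by that of red, the three size equations form the system solved by
-- `cyclic-sizes`.
balanced : (w : Vec Fate n) {S : Subset n} → IsDealOn S (deal w) → Balanced w
balanced w d = cyclic-sizes {total (received red) w}
  (red-size w)
  (trans (cong (_+ total (passed blue) w) (as-red green)) (green-size w))
  (trans (cong (_+ total (passed red) w) (as-red blue)) (blue-size w))
  where
  as-red : ∀ p → total (received red) w ≡ total (received p) w
  as-red p = trans (sym (hand-size w red)) (trans (IsDealOn.equalSize d red p) (hand-size w p))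

-- Counting by denomination set

∣dealtSet∣ : (w : Vec Fate n) → ∣ dealtSet w ∣ ≡ total dealt w
∣dealtSet∣ w = trans (∣∣-total (dealtSet w)) (total-map bit is-just w)

deals-by-size↔ : ∀ n k →
  [ H ∈ Hands n ∣ (∃[ S ] (IsDealOn S H × ∣ S ∣ ≡ k)) ] ↔
  [ w ∈ Vec Fate n ∣ total dealt w ≡ k × Balanced w ]
deals-by-size↔ n k = refine-deals↔ (λ (S , d , _) → S , d) λ w → mk⇔
  (λ (S , d , size) → let b = balanced w d in
    trans (sym (∣dealtSet∣ w))
      -- The given `S` can only be `dealtSet w`, whose size is known.
      (trans (cong ∣_∣ (denominationSet-unique (deal-balanced w b) d)) size) ,
    b)
  (λ (size , b) → dealtSet w , deal-balanced w b , trans (∣dealtSet∣ w) size)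

optional↔ : Maybe A ↔ Σ Bool (Vec A ∘ bit)
optional↔ = mk↔ₛ′
  (λ { nothing → false , [] ; (just a) → true , a ∷ [] })
  (λ { (false , []) → nothing ; (true , a ∷ []) → just a })
  (λ { (false , []) → refl ; (true , _ ∷ []) → refl })
  (λ { nothing → refl ; (just _) → refl })

passedBit : Color → Bool × Bool × Bool → ℕ
passedBit c b = passed c (just b)

EquallyPassed : Vec (Bool × Bool × Bool) m → Set
EquallyPassed v = total (passedBit red) v ≡ total (passedBit green) v ×
                  total (passedBit green) v ≡ total (passedBit blue) v

-- Undealt denominations pass no cards, so balance is a condition on the bit triples of the dealt
-- ones alone.
words-by-size↔ : ∀ n k →
  [ w ∈ Vec Fate n ∣ total dealt w ≡ k × Balanced w ] ↔
  (Choice n k × [ v ∈ Vec (Bool × Bool × Bool) k ∣ EquallyPassed v ])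
words-by-size↔ n k = ↔-trans (refine-↔ sort↔ same) (refine-Σ-Vec EquallyPassed (total bit) λ _ → id)
  where
  open Sorting optional↔

  shapes : (w : Vec Fate n) → total bit (proj₁ (sort w)) ≡ total dealt w
  shapes w = trans (total-shapes bit w)
    (total-cong (λ { nothing → refl ; (just _) → refl }) w)

  contents : ∀ c (w : Vec Fate n) →
             total (passedBit c) (proj₂ (sort w)) ≡ total (passed c) w
  contents c w = trans (total-contents (passedBit c) w)
    (total-cong (λ { nothing → refl ; (just _) → +-identityʳ _ }) w)

  same : ∀ w → (total dealt w ≡ k × Balanced w) ⇔
               (total bit (proj₁ (sort w)) ≡ k × EquallyPassed (proj₂ (sort w)))
  same w = ≡⇒ (sym (cong₂ _×_ (cong (_≡ k) (shapes w))
    (cong₂ _×_ (cong₂ _≡_ (contents red w) (contents green w))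
               (cong₂ _≡_ (contents green w) (contents blue w)))))

-- Each coordinate of the `k` bit triples is the indicator of one subset.
equally-passed↔ : ∀ k →
  [ v ∈ Vec (Bool × Bool × Bool) k ∣ EquallyPassed v ] ↔
  [ STU ∈ Subset k × Subset k × Subset k ∣ EqualSizes STU ]
equally-passed↔ k = refine-↔ (↔-trans unzip↔ (×-cong ↔-refl unzip↔)) same
  where
  unzip↔ : Vec (A × B) n ↔ (Vec A n × Vec B n)
  unzip↔ = ↔-sym ×v↔v×

  same : ∀ v → EquallyPassed v ⇔
    EqualSizes (proj₁ (unzip v) , unzip (proj₂ (unzip v)))
  same v = ≡⇒ (sym (cong₂ _×_ (cong₂ _≡_ S≡ T≡) (cong₂ _≡_ T≡ U≡)))
    where
    S≡ = total-unzip₁ bit v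
    T≡ = trans (total-unzip₁ bit (proj₂ (unzip v))) (total-unzip₂ (bit ∘ proj₁) v)
    U≡ = trans (total-unzip₂ bit (proj₂ (unzip v))) (total-unzip₂ (bit ∘ proj₂) v)

-- Counting by the denominations in the red hand

-- The red player gets the green card when `y` is false and the blue card when `z` is true.
occurs : Fate → Bool
occurs nothing            = false
occurs (just (x , y , z)) = not y ∨ z

occurs-owned : ∀ f → occurs f ≡ true → ∃[ c ] owns f red c ≡ true
occurs-owned (just (_ , false , _))    _ = green , refl
occurs-owned (just (_ , true  , true)) _ = blue , refl

owned-occurs : ∀ f c → owns f red c ≡ true → occurs f ≡ true
owned-occurs (just (_ , false , _))    _     _ = refl
owned-occurs (just (_ , true  , true)) _     _ = refl
owned-occurs (just (_ , true , false)) red   ()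
owned-occurs (just (_ , true , false)) green ()
owned-occurs (just (_ , true , false)) blue  ()

∣occurring∣ : (w : Vec Fate n) →
              ∣ occurringDenominations (deal w) red ∣ ≡ total (bit ∘ occurs) w
∣occurring∣ w = begin
  ∣ occurringDenominations (deal w) red ∣ ≡⟨ cong ∣_∣ (tabulate-cong occurring) ⟩
  ∣ tabulate (occurs ∘ lookup w) ∣        ≡⟨ cong ∣_∣ (tabulate-∘ occurs (lookup w)) ⟩
  ∣ Vec.map occurs (tabulate (lookup w)) ∣ ≡⟨ cong (∣_∣ ∘ Vec.map occurs) (tabulate∘lookup w) ⟩
  ∣ Vec.map occurs w ∣                    ≡⟨ ∣∣-total (Vec.map occurs w) ⟩
  total bit (Vec.map occurs w)            ≡⟨ total-map bit occurs w ⟩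
  total (bit ∘ occurs) w                  ∎
  where
  open ≡-Reasoning

  does-bit : {P : Set} (P? : Dec P) (b : Bool) →
             (P → b ≡ true) → (b ≡ true → P) → does P? ≡ b
  does-bit (yes p) b     P⇒b _   = sym (P⇒b p)
  does-bit (no ¬p) true  _   b⇒P = contradiction (b⇒P refl) ¬p
  does-bit (no ¬p) false _   _   = refl

  occurring : ∀ i → does (Fin.any? λ c → card c i ∈? hand (deal w) red) ≡ occurs (lookup w i)
  occurring i = does-bit (Fin.any? λ c → card c i ∈? hand (deal w) red) _
    (λ (c , x∈red) → owned-occurs (lookup w i) c
      (trans (sym (holds-deal w i red c)) ([]=⇒lookup x∈red)))
    (λ e → let c , o = occurs-owned (lookup w i) e in
      c , lookup⇒[]= _ _ (trans (holds-deal w i red c) o))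

deals-by-occurrence↔ : ∀ n k →
  [ H ∈ Hands n ∣ (IsDeal H × ∣ occurringDenominations H red ∣ ≡ k) ] ↔
  [ w ∈ Vec Fate n ∣ Balanced w × total (bit ∘ occurs) w ≡ k ]
deals-by-occurrence↔ n k = refine-deals↔ proj₁ λ w → mk⇔
  (λ ((S , d) , occ) → balanced w d , trans (sym (∣occurring∣ w)) occ)
  (λ (b , occ) → (dealtSet w , deal-balanced w b) , trans (∣occurring∣ w) occ)

arity₂ : Bool × Bool → ℕ
arity₂ (k , l) = bit k + bit l

-- A dealt denomination lies in both K and L iff `y` and `z` agree; then `not y` determines both and
-- precedes `x`. Otherwise the one set containing it determines `y` and `z`, and only `x` is left.
pair↔ : Fate ↔ Σ (Bool × Bool) (Vec Bool ∘ arity₂)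
pair↔ = mk↔ₛ′ to from
  (λ { ((false , false) , [])            → refl
     ; ((false , true ) , _ ∷ [])        → refl
     ; ((true  , false) , _ ∷ [])        → refl
     ; ((true  , true ) , true  ∷ _ ∷ []) → refl
     ; ((true  , true ) , false ∷ _ ∷ []) → refl })
  (λ { nothing                    → refl
     ; (just (_ , true  , true )) → refl
     ; (just (_ , true  , false)) → refl
     ; (just (_ , false , true )) → refl
     ; (just (_ , false , false)) → refl })
  where
  to : Fate → Σ (Bool × Bool) (Vec Bool ∘ arity₂)
  to nothing                    = (false , false) , []
  to (just (x , true  , true )) = (true  , true ) , false ∷ x ∷ []
  to (just (x , true  , false)) = (false , true ) , x ∷ []
  to (just (x , false , true )) = (true  , false) , x ∷ []
  to (just (x , false , false)) = (true  , true ) , true ∷ x ∷ []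

  from : Σ (Bool × Bool) (Vec Bool ∘ arity₂) → Fate
  from ((false , false) , [])             = nothing
  from ((false , true ) , x ∷ [])         = just (x , true , false)
  from ((true  , false) , x ∷ [])         = just (x , false , true)
  from ((true  , true ) , true  ∷ x ∷ []) = just (x , false , false)
  from ((true  , true ) , false ∷ x ∷ []) = just (x , true , true)

-- Its total is the common correction u between the passed totals and the counts for K, L and the
-- further bits.
unpassed : Fate → ℕ
unpassed nothing            = 0
unpassed (just (_ , y , z)) = bit (not (y ∨ z))

BothOfSize : ℕ → Vec (Bool × Bool) n → Set
BothOfSize k v = total (bit ∘ proj₁) v ≡ k × total (bit ∘ proj₂) v ≡ k

words-by-occurrence↔ : ∀ n k →
  [ w ∈ Vec Fate n ∣ Balanced w × total (bit ∘ occurs) w ≡ k ] ↔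
  ([ v ∈ Vec (Bool × Bool) n ∣ BothOfSize k v ] × Choice (2 * k) k)
words-by-occurrence↔ n k = ↔-trans (refine-↔ sort↔ same)
  (refine-Σ-Vec (λ xs → total bit xs ≡ k) (total arity₂) both)
  where
  open Sorting pair↔

  both : ∀ (v : Vec (Bool × Bool) n) → BothOfSize k v → total arity₂ v ≡ 2 * k
  both v (p , q) = trans (total-+ (bit ∘ proj₁) (bit ∘ proj₂) v)
    -- `2 * k` unfolds to `k + (k + 0)`.
    (cong₂ _+_ p (trans q (sym (+-identityʳ k))))

  module _ (w : Vec Fate n) where
    K = total (bit ∘ proj₁) (proj₁ (sort w))
    L = total (bit ∘ proj₂) (proj₁ (sort w))
    C = total bit (proj₂ (sort w))
    u = total unpassed w

    occurs≡K : total (bit ∘ occurs) w ≡ K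
    occurs≡K = sym (trans (total-shapes (bit ∘ proj₁) w)
      (total-cong (λ { nothing → refl
                     ; (just (_ , true  , true )) → refl
                     ; (just (_ , true  , false)) → refl
                     ; (just (_ , false , true )) → refl
                     ; (just (_ , false , false)) → refl }) w))

    blue+u : total (passed blue) w + u ≡ K
    blue+u = trans (total-+-cong (λ { nothing → refl
                     ; (just (_ , true  , true )) → refl
                     ; (just (_ , true  , false)) → refl
                     ; (just (_ , false , true )) → refl
                     ; (just (_ , false , false)) → refl }) w)
      (sym (total-shapes (bit ∘ proj₁) w))

    green+u : total (passed green) w + u ≡ L
    green+u = trans (total-+-cong (λ { nothing → refl
                     ; (just (_ , true  , true )) → refl
                     ; (just (_ , true  , false)) → refl
                     ; (just (_ , false , true )) → refl
                     ; (just (_ , false , false)) → refl }) w)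
      (sym (total-shapes (bit ∘ proj₂) w))

    red+u : total (passed red) w + u ≡ C
    red+u = trans (total-+-cong (λ { nothing → refl
                     ; (just (x , true  , true )) → refl
                     ; (just (x , true  , false)) → refl
                     ; (just (x , false , true )) → refl
                     -- Here `unpassed` contributes 1, matching the leading `true` of the content.
                     ; (just (x , false , false)) →
                         trans (+-comm (bit x) 1) (cong suc (sym (+-identityʳ (bit x)))) }) w)
      (sym (total-contents bit w))

    -- `K`, `L` and `C` exceed the passed totals of blue, green and red by the same `u`, so balance
    -- means that the three coincide.
    same : (Balanced w × total (bit ∘ occurs) w ≡ k) ⇔ ((K ≡ k × L ≡ k) × C ≡ k)
    same = mk⇔
      (λ ((x≡y , y≡z) , occ) →
        let K≡k = trans (sym occurs≡K) occ
            L≡k = trans (sym green+u) (trans (cong (_+ u) y≡z) (trans blue+u K≡k))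
        in (K≡k , L≡k) , trans (sym red+u) (trans (cong (_+ u) x≡y) (trans green+u L≡k)))
      (λ ((K≡k , L≡k) , C≡k) →
        ( +-cancelʳ-≡ u _ _ (trans red+u (trans C≡k (sym (trans green+u L≡k))))
        , +-cancelʳ-≡ u _ _ (trans green+u (trans L≡k (sym (trans blue+u K≡k)))) )
        , trans occurs≡K K≡k)

two-choices↔ : ∀ n k →
  [ v ∈ Vec (Bool × Bool) n ∣ BothOfSize k v ] ↔ (Choice n k × Choice n k)
two-choices↔ n k = ↔-trans (refine-↔ (↔-sym ×v↔v×) same) refine-×
  where
  same : ∀ v → BothOfSize k v ⇔
    (total bit (proj₁ (unzip v)) ≡ k × total bit (proj₂ (unzip v)) ≡ k)
  same v = ≡⇒ (sym (cong₂ _×_ (cong (_≡ k) (total-unzip₁ bit v))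
                              (cong (_≡ k) (total-unzip₂ bit v))))

mainTheorem1 : (n k : ℕ) → k ≤ n →
    ([ H ∈ Hands n ∣ (∃[ S ] (IsDealOn S H × ∣ S ∣ ≡ k)) ]
    ↔ Fin ((n C k) * sum (map (λ j → (k C j) ^ 3) (upTo (suc k)))))
    ×
    ([ H ∈ Hands n ∣ (IsDeal H × ∣ occurringDenominations H red ∣ ≡ k) ]
    ↔ Fin ((n C k) ^ 2 * ((2 * k) C k)))
mainTheorem1 n k _ =
  ↔-trans (deals-by-size↔ n k) (↔-trans (words-by-size↔ n k)
    (↔-trans (×-cong (choice↔ n k) (↔-trans (equally-passed↔ k) (equal-sizes↔ k)))
      (↔-sym Fin.*↔×))) ,
  ↔-trans (deals-by-occurrence↔ n k) (↔-trans (words-by-occurrence↔ n k)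
    (↔-trans (×-cong (↔-trans (two-choices↔ n k)
                        (↔-trans (×-cong (choice↔ n k) (choice↔ n k)) (Fin-square-↔ (n C k))))
                     (choice↔ (2 * k) k))
      (↔-sym Fin.*↔×)))
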